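{- Let $X$ be a countable, second countable topological space. Then $\mathcal{M}(X)$ is a $\boldsymbol{\Pi}^0_3$ subset of $\mathcal{P}(X)$.
   Context: "Countable" means countably infinite (the paper writes "at most countable" when finite sets are allowed). For a topological space $X$, a subset $A\subseteq X$ is dense in an open set $U$ if $U\subseteq\overline{A}$, and codense in $U$ if $U\subseteq\overline{X\setminus A}$. A subset $A\subseteq X$ is monitorable if for every non-empty open set $U\subseteq X$ either $A$ is not dense in $U$ or $A$ is not codense in $U$. $\mathcal{M}(X)\subseteq\mathcal{P}(X)$ denotes the family of monitorable subsets of $X$. The powerset $\mathcal{P}(X)$ is identified with $2^X$ via characteristic functions and carries the product topology (with $2=\{0,1\}$ discrete); for countable $X$ it is homeomorphic to the Cantor space. $\boldsymbol{\Sigma}^0_\alpha,\boldsymbol{\Pi}^0_\alpha$ are the usual classes of the Borel hierarchy: $\boldsymbol{\Sigma}^0_1(Z)$ is the family of open sets of $Z$, $\boldsymbol{\Pi}^0_\alpha(Z)$ is the family of complements of $\boldsymbol{\Sigma}^0_\alpha(Z)$ sets, and for $\alpha\ge2$, $\boldsymbol{\Sigma}^0_\alpha(Z)$ consists of the at most countable unions of members of $\bigcup_{\beta<\alpha}\boldsymbol{\Pi}^0_\beta(Z)$. -}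

module Defs where

open import Data.Bool using (Bool; true)
open import Data.List using (List; []; _∷_; _++_)
open import Data.List.Membership.Propositional using () renaming (_∈_ to _∈ˡ_)
open import Data.List.Membership.Propositional.Properties using (∈-++⁺ˡ; ∈-++⁺ʳ)
open import Data.Nat using (ℕ; _≤_; _<_)
open import Data.Product using (Σ-syntax; ∃-syntax; _×_; _,_; proj₁; proj₂)
open import Data.Sum using (_⊎_)
open import Data.Unit using (⊤; tt)
open import Function.Bundles using (_↣_; _⤖_)
open import Level using (Level; 0ℓ; _⊔_; Lift; lift) renaming (suc to lsuc)
open import Relation.Binary.PropositionalEquality using (_≡_)
open import Relation.Nullary using (¬_)
open import Relation.Unary using (Pred; U; _∈_; _⊆_; _≐_; _∩_; ∁; ⋃; Satisfiable; _≬_)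

private
  variable
    ℓ : Level

Countable : Set → Set
Countable X = X ⤖ ℕ

AtMostCountable : Set → Set
AtMostCountable X = X ↣ ℕ

-- Subsets are predicates, compared by _≐_, hence the field `resp`.
-- The empty set is open as the union of the family indexed by ⊥.
record Topology (X : Set) : Set₂ where
  field
    IsOpen : Pred (Pred X 0ℓ) (lsuc 0ℓ)
    resp   : ∀ {V W} → V ≐ W → IsOpen V → IsOpen W
    univ   : IsOpen U
    inter  : ∀ {V W} → IsOpen V → IsOpen W → IsOpen (V ∩ W)
    union  : ∀ (I : Set) (V : I → Pred X 0ℓ) → (∀ i → IsOpen (V i)) → IsOpen (⋃ I V)

open Topology using (IsOpen)

module _ {X : Set} (τ : Topology X) where

  IsBase : {I : Set} → (I → Pred X 0ℓ) → Set₁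
  IsBase {I} B =
    (∀ i → IsOpen τ (B i)) ×
    (∀ V → IsOpen τ V → ∀ x → x ∈ V → ∃[ i ] (x ∈ B i × B i ⊆ V))

  SecondCountable : Set₁
  SecondCountable =
    Σ[ I ∈ Set ] (AtMostCountable I × Σ[ B ∈ (I → Pred X 0ℓ) ] IsBase B)

  closure : Pred X ℓ → Pred X _
  closure A x = ∀ V → IsOpen τ V → x ∈ V → V ≬ A

  DenseIn : Pred X 0ℓ → Pred X 0ℓ → Set₁
  DenseIn A V = V ⊆ closure A

  CodenseIn : Pred X 0ℓ → Pred X 0ℓ → Set₁
  CodenseIn A V = V ⊆ closure (∁ A)

  Monitorable : Pred X 0ℓ → Set₁
  Monitorable A =
    ∀ V → IsOpen τ V → Satisfiable V → ¬ DenseIn A V ⊎ ¬ CodenseIn A V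

discrete : (X : Set) → Topology X
discrete X = record
  { IsOpen = λ _ → Lift _ ⊤
  ; resp   = λ _ _ → lift tt
  ; univ   = lift tt
  ; inter  = λ _ _ → lift tt
  ; union  = λ _ _ _ → lift tt
  }

-- V i is open for every i, but only the finitely many V i with i in the list
-- J constrain a point of the box: these are the products of open sets in which
-- all but finitely many factors are the whole space.
box : {I : Set} {Y : I → Set} → List I → (∀ i → Pred (Y i) 0ℓ) → Pred (∀ i → Y i) 0ℓ
box J V g = ∀ i → i ∈ˡ J → g i ∈ V i

product : {I : Set} {Y : I → Set} → (∀ i → Topology (Y i)) → Topology (∀ i → Y i)
product {I} {Y} τ = record
  { IsOpen = Open
  ; resp   = λ (W⊆W′ , W′⊆W) oW f f∈W′ →
      let J , V , oV , f∈V , sub = oW f (W′⊆W f∈W′)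
      in  J , V , oV , f∈V , λ g∈ → W⊆W′ (sub g∈)
  ; univ   = λ f _ →
      [] , (λ _ → U) , (λ i → Topology.univ (τ i)) , (λ _ → tt) , λ _ → tt
  ; inter  = λ oW oW′ f (f∈W , f∈W′) →
      let J , V , oV , f∈V , sub = oW f f∈W
          K , T , oT , f∈T , sub′ = oW′ f f∈W′
      in  J ++ K
        , (λ i → V i ∩ T i)
        , (λ i → Topology.inter (τ i) (oV i) (oT i))
        , (λ i → f∈V i , f∈T i)
        , λ g∈ → sub  (λ i i∈J → proj₁ (g∈ i (∈-++⁺ˡ i∈J)))
               , sub′ (λ i i∈K → proj₂ (g∈ i (∈-++⁺ʳ J i∈K)))
  ; union  = λ _ W oW f (k , f∈W) →
      let J , V , oV , f∈V , sub = oW k f f∈W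
      in  J , V , oV , f∈V , λ g∈ → k , sub g∈
  }
  where
  Open : Pred (Pred (∀ i → Y i) 0ℓ) (lsuc 0ℓ)
  Open W = ∀ f → f ∈ W →
    ∃[ J ] Σ[ V ∈ (∀ i → Pred (Y i) 0ℓ) ]
      ((∀ i → IsOpen (τ i) (V i)) × (∀ i → f i ∈ V i) × box J V ⊆ W)

module _ {Z : Set} (τ : Topology Z) where

  -- The finite levels 1, 2, 3, … of the Borel hierarchy; both classes are empty
  -- at level 0, so the levels β in `unions` satisfy 1 ≤ β < α.
  -- The level of S in Π⁰ is left free because ℳ below quantifies over open
  -- sets and so is a predicate one universe up.
  data Σ⁰ : ℕ → Pred (Pred Z 0ℓ) (lsuc 0ℓ)
  Π⁰ : ℕ → Pred (Pred Z ℓ) (lsuc 0ℓ ⊔ ℓ)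

  data Σ⁰ where
    opens  : ∀ {S} → IsOpen τ S → Σ⁰ 1 S
    unions : ∀ {α S} → 2 ≤ α →
             (I : Set) → AtMostCountable I → (F : I → Pred Z 0ℓ) →
             (∀ i → ∃[ β ] (β < α × Π⁰ β (F i))) →
             S ≐ ⋃ I F → Σ⁰ α S

  Π⁰ α S = Σ[ T ∈ Pred Z 0ℓ ] (Σ⁰ α T × S ≐ ∁ T)

𝒫 : Set → Set
𝒫 X = X → Bool

⟦_⟧ : {X : Set} → 𝒫 X → Pred X 0ℓ
⟦ A ⟧ x = A x ≡ true

𝒫-topology : (X : Set) → Topology (𝒫 X)
𝒫-topology X = product (λ (_ : X) → discrete Bool)

ℳ : {X : Set} → Topology X → Pred (𝒫 X) (lsuc 0ℓ)
ℳ τ A = Monitorable τ ⟦ A ⟧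

{-# OPTIONS --safe #-}
-- A is not monitorable iff A is dense and codense in some non-empty basic open
-- set B i, that is, iff every B j meeting B i contains a point of A and a point
-- of the complement of A.  For fixed j the last condition is open in A, since it
-- is witnessed by two values of the characteristic function.  Hence the
-- non-monitorable sets form a countable union of countable intersections of
-- open sets.
module Submission where

open import Defs
open import Axiom.ExcludedMiddle using (ExcludedMiddle)
open import Level using (0ℓ; lift; lower; Lift) renaming (suc to lsuc)

open import Data.Bool using (Bool; true)
open import Data.Empty using (⊥-elim)
open import Data.List using ([]; _∷_)
open import Data.List.Relation.Unary.Any using (here)
open import Data.Nat.Properties using (≤-refl; n≤1+n)
open import Data.Product using (_×_; _,_; proj₁; proj₂)
open import Data.Sum using (inj₁; inj₂)
open import Data.Unit using (tt)
open import Function using (id)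
open import Relation.Binary.PropositionalEquality using (_≡_; refl; subst)
open import Relation.Nullary using (¬_; Dec; yes; no)
open import Relation.Nullary.Decidable using (map′; decidable-stable)
open import Relation.Unary using (Pred; _∈_; _⊆_; ∁; ⋃; ⋂; Satisfiable; _≬_)

open Topology

lowerEM : ExcludedMiddle (lsuc 0ℓ) → ExcludedMiddle 0ℓ
lowerEM em {P} = map′ lower lift (em {Lift (lsuc 0ℓ) P})

module _ {Z : Set} (τ : Topology Z) where

  -- Since `P` does not depend on `z`, the set is `W` or the whole space.
  ⇒-open : {P : Set} → Dec P → {W : Pred Z 0ℓ} →
           IsOpen τ W → IsOpen τ (λ z → P → z ∈ W)
  ⇒-open (yes p) oW = resp τ ((λ w _ → w) , (λ f → f p)) oW
  ⇒-open (no ¬p) _  = resp τ ((λ _ p → ⊥-elim (¬p p)) , (λ _ → tt)) (univ τ)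

  ⋂-open⇒Π⁰₂ : ExcludedMiddle 0ℓ → {I : Set} → AtMostCountable I →
               (W : I → Pred Z 0ℓ) → (∀ i → IsOpen τ (W i)) → Π⁰ τ 2 (⋂ I W)
  ⋂-open⇒Π⁰₂ em {I} amc W oW =
      ⋃ I (λ i → ∁ (W i))
    , unions ≤-refl I amc (λ i → ∁ (W i))
        (λ i → 1 , ≤-refl , W i , opens (oW i) , id , id)
        (id , id)
    , (λ w (i , ¬w) → ¬w (w i))
    , (λ ¬w i → decidable-stable em (λ ¬wi → ¬w (i , ¬wi)))

-- One point `x` witnesses membership, so fixing the single coordinate `x` gives a box inside the
-- set.
hits-open : {X : Set} (S : Pred X 0ℓ) (P : Pred Bool 0ℓ) →
            IsOpen (𝒫-topology X) (λ A → S ≬ (λ x → A x ∈ P))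
hits-open S P f (x , x∈S , fx∈P) =
    x ∷ []
  , (λ y b → f y ≡ b)
  , (λ _ → lift tt)
  , (λ _ → refl)
  , λ g∈ → x , x∈S , subst P (g∈ x (here refl)) fx∈P

module _ {X : Set} (τ : Topology X) {I : Set} {B : I → Pred X 0ℓ} (base : IsBase τ B) where

  closure-base : {S : Pred X 0ℓ} {x : X} →
                 (∀ j → x ∈ B j → B j ≬ S) → x ∈ closure τ S
  closure-base meets V oV x∈V =
    let j , x∈Bj , Bj⊆V = proj₂ base V oV _ x∈V
        y , y∈Bj , y∈S  = meets j x∈Bj
    in  y , Bj⊆V y∈Bj , y∈S

  closure-meets : {V S : Pred X 0ℓ} → V ⊆ closure τ S → ∀ j → B j ≬ V → B j ≬ S
  closure-meets V⊆ j (x , x∈Bj , x∈V) = V⊆ x∈V (B j) (proj₁ base j) x∈Bj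

  Splits : I → Pred (𝒫 X) 0ℓ
  Splits j A = B j ≬ ⟦ A ⟧ × B j ≬ ∁ ⟦ A ⟧

  -- Non-emptiness of B i is a conjunct rather than a restriction of the index
  -- set, which therefore remains I and at most countable.
  SplitsOn : I → I → Pred (𝒫 X) 0ℓ
  SplitsOn i j A = Satisfiable (B i) × (B j ≬ B i → A ∈ Splits j)

  -- Quantifying over basic indices instead of open sets keeps this predicate at level `0ℓ`, as `Σ⁰`
  -- demands.
  NonMonitorable : Pred (𝒫 X) 0ℓ
  NonMonitorable = ⋃ I (λ i → ⋂ I (SplitsOn i))

  SplitsOn-open : ExcludedMiddle 0ℓ → ∀ i j → IsOpen (𝒫-topology X) (SplitsOn i j)
  SplitsOn-open em i j =
    -- The conjunct `Satisfiable (B i)` is constant in `A`, so the pair is a union indexed by its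
    -- proofs.
    union 𝒫X (Satisfiable (B i)) (λ _ A → B j ≬ B i → A ∈ Splits j) λ _ →
      ⇒-open 𝒫X em
        (inter 𝒫X (hits-open (B j) (_≡ true)) (hits-open (B j) (λ b → ¬ b ≡ true)))
    where 𝒫X = 𝒫-topology X

  NonMonitorable-Σ⁰₃ : ExcludedMiddle 0ℓ → AtMostCountable I →
                       Σ⁰ (𝒫-topology X) 3 NonMonitorable
  NonMonitorable-Σ⁰₃ em amc =
    unions (n≤1+n 2) I amc (λ i → ⋂ I (SplitsOn i))
      (λ i → 2 , ≤-refl , ⋂-open⇒Π⁰₂ _ em amc (SplitsOn i) (SplitsOn-open em i))
      (id , id)

  ℳ⊆∁NonMonitorable : ℳ τ ⊆ ∁ NonMonitorable
  ℳ⊆∁NonMonitorable mon (i , splits)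
    -- Every `splits j` carries the non-emptiness of `B i`; the choice `j = i` is just an available
    -- index.
    with mon (B i) (proj₁ base i) (proj₁ (splits i))
  ... | inj₁ ¬dense   = ¬dense λ x∈Bi → closure-base λ j x∈Bj →
                          proj₁ (proj₂ (splits j) (_ , x∈Bj , x∈Bi))
  ... | inj₂ ¬codense = ¬codense λ x∈Bi → closure-base λ j x∈Bj →
                          proj₂ (proj₂ (splits j) (_ , x∈Bj , x∈Bi))

  ∁NonMonitorable⊆ℳ : ExcludedMiddle (lsuc 0ℓ) → ∁ NonMonitorable ⊆ ℳ τ
  ∁NonMonitorable⊆ℳ em {A} ¬nm V oV (x , x∈V) with em {DenseIn τ ⟦ A ⟧ V}
  ... | no ¬dense = inj₁ ¬dense
  ... | yes dense = inj₂ λ codense →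
    -- Density and codensity in `V` pass to a basic set around `x` inside `V`, which then
    -- contradicts `¬nm`.
    let i , x∈Bi , Bi⊆V = proj₂ base V oV x x∈V
    in  ¬nm (i , λ j → (x , x∈Bi) , λ (y , y∈Bj , y∈Bi) →
          let meets = y , y∈Bj , Bi⊆V y∈Bi
          in  closure-meets dense j meets , closure-meets codense j meets)

proposition3p1 : ExcludedMiddle (lsuc 0ℓ) →
    (X : Set) (τ : Topology X) → Countable X → SecondCountable τ →
    Π⁰ (𝒫-topology X) 3 (ℳ τ)
proposition3p1 em X τ _ (I , amc , B , base) =
    NonMonitorable τ base
  , NonMonitorable-Σ⁰₃ τ base (lowerEM em) amc
  , ℳ⊆∁NonMonitorable τ base
  , ∁NonMonitorable⊆ℳ τ base em
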